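{- Let $q=3^d$ with $d\ge 1$, and let $\alpha\in\mathbb{F}_q$ be a fixed element with $\operatorname{Tr}(\alpha)=1$. Let $E\colon y^2=x^3+a_4x+a_6$ be an elliptic curve over $\mathbb{F}_q$ (so $a_4\neq 0$) of Type I, i.e. $-a_4=v^4$ for some $v\in\mathbb{F}_q^\times$. Then $E$ is isomorphic over $\mathbb{F}_q$ to $E_b\colon y^2=x^3-x+b$ with $b=a_6v^{ -6}$, and every elliptic curve $y^2=x^3+a_4'x+a_6'$ over $\mathbb{F}_q$ that is isomorphic to $E$ over $\mathbb{F}_q$ is also of Type I. Moreover, for $b \in \mathbb{F}_q$, the curves $E_b\colon y^2=x^3-x+b$ are classified up to $\mathbb{F}_q$-isomorphism as follows. If $d$ is odd, there are exactly three isomorphism classes, and the class of $E_b$ depends only on (and is determined by) $\operatorname{Tr}(b)\in\mathbb{F}_3$: (i) if $\operatorname{Tr}(b)=0$, then $E_b$ is isomorphic to $E_0$; (ii) if $\operatorname{Tr}(b)=1$, then $E_b$ is isomorphic to $E_\alpha$; (iii) if $\operatorname{Tr}(b)=-1$, then $E_b$ is isomorphic to the quadratic twist of $E_\alpha$ by $-1$. If $d$ is even, there are exactly two isomorphism classes: (i) if $\operatorname{Tr}(b)=0$, then $E_b$ is isomorphic to $E_0$; (ii) if $\operatorname{Tr}(b)\neq 0$, then $E_b$ is isomorphic to $E_\alpha$.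
   Context: $\operatorname{Tr}$ denotes the trace map $\mathbb{F}_q\to\mathbb{F}_3$. In characteristic $3$, every supersingular elliptic curve over $\mathbb{F}_q$ can be written as $y^2=x^3+a_4x+a_6$ with $a_4\neq0$. For $D\in\mathbb{F}_q^\times$ a non-square, the quadratic twist of $y^2=x^3+ax+c$ by $D$ is $y^2=x^3+D^2ax+D^3c$; note that $-1$ is a non-square in $\mathbb{F}_q$ when $d$ is odd. -}

module Defs where

open import Level using (Level; _⊔_)
open import Algebra.Apartness.Bundles using (HeytingField; HeytingCommutativeRing)
open import Algebra.Bundles using (CommutativeRing; Semiring)
open import Data.Fin.Base using (Fin)
open import Data.Nat.Base as ℕ using (ℕ; zero; suc)
open import Data.Product.Base using (Σ-syntax; ∃-syntax; _×_; proj₁)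
open import Function.Bundles using (Inverse)
open import Relation.Binary.Core using (Rel)
open import Relation.Binary.PropositionalEquality using (_≡_)
import Relation.Binary.PropositionalEquality as ≡
open import Relation.Nullary.Negation using (¬_)
import Algebra.Definitions.RawSemiring as RawSemiringDefs

-- The relation _~_ (in every use below, an equivalence) has exactly n classes:
-- there is a system of n pairwise inequivalent representatives.
HasExactlyClasses : ∀ {a ℓ} {A : Set a} → ℕ → Rel A ℓ → Set (a ⊔ ℓ)
HasExactlyClasses {A = A} n _~_ =
  Σ[ rep ∈ (Fin n → A) ]
    (∀ i j → rep i ~ rep j → i ≡ j) × (∀ x → ∃[ i ] x ~ rep i)

-- In a Heyting field, x # 0# holds exactly when x is invertible, and _≈_ is the
-- negation of _#_; for the finite fields considered, # is therefore just ≉.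
module OverField {c ℓ₁ ℓ₂ : Level} (F : HeytingField c ℓ₁ ℓ₂) where

  open HeytingField F

  commutativeRing : CommutativeRing c ℓ₁
  commutativeRing = HeytingCommutativeRing.commutativeRing heytingCommutativeRing

  -- _·_ is the multiple of a field element by a natural number.
  open RawSemiringDefs (Semiring.rawSemiring (CommutativeRing.semiring commutativeRing)) public
    using (_^_) renaming (_×_ to infixr 8 _·_)

  HasCardinality : ℕ → Set (c ⊔ ℓ₁)
  HasCardinality n = Inverse (CommutativeRing.setoid commutativeRing) (≡.setoid (Fin n))

  inverse : ∀ {x} → x # 0# → Carrier
  inverse x#0 = proj₁ (#⇒invertible x#0)

  NonSquare : Carrier → Set (c ⊔ ℓ₁)
  NonSquare x = ¬ (∃[ y ] x ≈ y ^ 2)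

  -- trace d x = x + x³ + x⁹ + … + x^(3^(d-1)), which for a field of 3^d elements is
  -- the trace to 𝔽₃, identified with the prime subfield {0#, 1#, - 1#}.
  trace : ℕ → Carrier → Carrier
  trace zero    x = 0#
  trace (suc d) x = trace d x + x ^ (3 ℕ.^ d)

  -- y² + a₁xy + a₃y = x³ + a₂x² + a₄x + a₆
  record Weierstrass : Set c where
    constructor weierstrass
    field
      a₁ a₂ a₃ a₄ a₆ : Carrier

    b₂ b₄ b₆ b₈ Δ : Carrier
    b₂ = a₁ ^ 2 + 4 · a₂
    b₄ = 2 · a₄ + a₁ * a₃
    b₆ = a₃ ^ 2 + 4 · a₆
    b₈ = a₁ ^ 2 * a₆ + 4 · (a₂ * a₆) - a₁ * a₃ * a₄ + a₂ * a₃ ^ 2 - a₄ ^ 2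
    Δ  = - (b₂ ^ 2 * b₈) - 8 · (b₄ ^ 3) - 27 · (b₆ ^ 2) + 9 · (b₂ * b₄ * b₆)

  IsElliptic : Weierstrass → Set ℓ₂
  IsElliptic E = Weierstrass.Δ E # 0#

  -- Isomorphism over F (respecting the point at infinity): a substitution
  --   x = u²x' + r,   y = u³y' + su²x' + t     (u ≠ 0)
  -- with coefficients in F carrying the equation of E to that of E'.  The fields
  -- compare coefficients after dividing the substituted equation by u⁶.
  record _≅_ (E E' : Weierstrass) : Set (c ⊔ ℓ₁ ⊔ ℓ₂) where
    open Weierstrass E
    open Weierstrass E' using ()
      renaming (a₁ to a₁'; a₂ to a₂'; a₃ to a₃'; a₄ to a₄'; a₆ to a₆')
    field
      u r s t : Carrier
      u#0     : u # 0#
      eq₁     : u * a₁' ≈ a₁ + 2 · s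
      eq₂     : u ^ 2 * a₂' ≈ a₂ - s * a₁ + 3 · r - s ^ 2
      eq₃     : u ^ 3 * a₃' ≈ a₃ + r * a₁ + 2 · t
      eq₄     : u ^ 4 * a₄' ≈
                a₄ - s * a₃ + 2 · (r * a₂) - (t + r * s) * a₁ + 3 · (r ^ 2) - 2 · (s * t)
      eq₆     : u ^ 6 * a₆' ≈
                a₆ + r * a₄ + r ^ 2 * a₂ + r ^ 3 - t * a₃ - t ^ 2 - r * t * a₁

  infix 4 _≅_

  -- y² = x³ + ax + c
  short : Carrier → Carrier → Weierstrass
  short a c = weierstrass 0# 0# 0# a c

  quadraticTwist : (D : Carrier) → NonSquare D → (a c : Carrier) → Weierstrass
  quadraticTwist D _ a c = short (D ^ 2 * a) (D ^ 3 * c)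

  TypeIVia : Carrier → Carrier → Set (ℓ₁ ⊔ ℓ₂)
  TypeIVia v a₄ = v # 0# × - a₄ ≈ v ^ 4

  -- Type I, as a condition on the coefficient a₄ of y² = x³ + a₄x + a₆.
  TypeI : Carrier → Set (c ⊔ ℓ₁ ⊔ ℓ₂)
  TypeI a₄ = ∃[ v ] TypeIVia v a₄

  -- y² = x³ - x + b
  curve : Carrier → Weierstrass
  curve b = short (- 1#) b

{-# OPTIONS --safe #-}
module Submission where

open import Level using (Level; _⊔_)
open import Algebra.Apartness.Bundles using (HeytingField)
open import Algebra.Bundles using (CommutativeMonoid; CommutativeRing; RawRing)
open import Data.Empty using (⊥-elim)
open import Data.Fin.Base as Fin using (Fin; punchIn; inject≤)
open import Data.Fin.Patterns using (0F; 1F; 2F)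
import Data.Fin.Permutation as Perm
import Data.Fin.Properties as Fin
open import Data.Maybe.Base using (just; nothing)
open import Data.Nat.Base as ℕ using (ℕ; zero; suc; s≤s; z≤n; _≤_) renaming (_^_ to _^ℕ_)
open import Data.Nat.Divisibility using (_∣_; _∤_; divides)
import Data.Nat.Properties as ℕ
import Data.Nat.Tactic.RingSolver as ℕ-Solver
open import Data.Product.Base using (Σ-syntax; ∃-syntax; _×_; proj₁; proj₂; _,_)
open import Data.Sum.Base using (_⊎_; inj₁; inj₂; [_,_]′)
open import Data.Vec.Functional using (Vector; removeAt)
open import Function.Base using (id; _∘_)
open import Function.Bundles using (_⇔_; mk⇔; Inverse)
open import Relation.Binary.Definitions using (Decidable; WeaklyDecidable)
open import Relation.Binary.PropositionalEquality as ≡ using (_≡_; _≢_)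
open import Relation.Nullary.Decidable using (yes; no; map′; ¬?; decidable-stable)
open import Relation.Nullary.Negation using (¬_; contradiction)
import Algebra.Apartness.Properties.HeytingCommutativeRing as HeytingProperties
import Algebra.Properties.CommutativeMonoid.Sum as Sum
import Algebra.Properties.Ring as RingProperties
import Algebra.Properties.Semiring.Exp as Exp
import Algebra.Properties.Semiring.Mult as Mult
import Algebra.Solver.Ring as RingSolver
import Algebra.Solver.Ring.NaturalCoefficients.Default as SemiringSolver
open import Algebra.Solver.Ring.AlmostCommutativeRing
  using (fromCommutativeRing; _-Raw-AlmostCommutative⟶_; Induced-equivalence)
import Relation.Binary.Reasoning.Setoid as ≈-Reasoning
open import Defs

-- Between short equations in characteristic 3 a substitution has s = t = 0, so
-- E_b ≅ E_b' amounts to u⁴ = 1 and u⁶b' = b + r³ - r for some r; as u² = ±1 and, by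
-- the additive Hilbert 90, {r³ - r} is the kernel of Tr, this says Tr b = ± Tr b',
-- the sign -1 being available exactly when -1 is a square, i.e. when d is even.

-- The field is known only through a bijection with `Fin q`, so its arithmetic has to be extracted
-- from that bijection: equality is decided on indices, inverses are found by search, and permuting
-- the summands or factors of a sum or product over the whole field gives characteristic 3 and
-- `x ^ q ≈ x`. The latter identity makes Frobenius cyclic of length d on the terms of the trace, so
-- that the trace lands in the prime field and kills every r³ - r. The converse inclusion needs an
-- element of trace 1, and α is used for this: it is the θ in the explicit Hilbert 90 formula. The
-- parity of d enters only through the question whether -1 is a square. For odd d a square root
-- would be negated by Frobenius to the power d; for even d one is obtained by counting roots of a
-- monic polynomial, without knowing that the multiplicative group is cyclic.

module _ {c ℓ} (M : CommutativeMonoid c ℓ) where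

  open CommutativeMonoid M
  open Sum M

  sum-single : ∀ {n} (i : Fin n) (t : Vector Carrier n) →
               (∀ j → j ≢ i → t j ≈ ε) → sum t ≈ t i
  sum-single {suc n} i t t≈ε = begin
    sum t                     ≈⟨ sum-remove {i = i} t ⟩
    t i ∙ sum (removeAt t i)  ≈⟨ ∙-congˡ (sum-cong-≋ (λ j → t≈ε (punchIn i j) (Fin.punchInᵢ≢i i j))) ⟩
    t i ∙ sum {n} (λ _ → ε)   ≈⟨ ∙-congˡ (sum-replicate-zero n) ⟩
    t i ∙ ε                   ≈⟨ identityʳ (t i) ⟩
    t i                       ∎
    where open ≈-Reasoning setoid

-- Monic polynomial functions and the bound on their roots.

module MonicPolynomials {c ℓ} (R : CommutativeRing c ℓ) where

  open CommutativeRing R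
  open RingProperties ring
  open Exp semiring using (_^_)
  open SemiringSolver commutativeSemiring using (solve; _:=_; _:+_; _:*_; con)
  open ≈-Reasoning setoid

  -- A Horner scheme attached to a function: the index is the degree, the leading coefficient 1 sits
  -- at the bottom, and agreement is only pointwise, so no separate syntax of polynomials has to be
  -- evaluated.
  data Monic : ℕ → (Carrier → Carrier) → Set (c ⊔ ℓ) where
    one   : ∀ {f} → (∀ x → f x ≈ 1#) → Monic 0 f
    shift : ∀ {n f g} → Monic n g → (a : Carrier) →
            (∀ x → f x ≈ x * g x + a) → Monic (suc n) f

  power : ∀ n → Monic n (_^ n)
  power zero    = one (λ _ → refl)
  power (suc n) = shift (power n) 0# (λ x → sym (+-identityʳ (x * x ^ n)))

  -- The factorisation f x - f a = (x - a) g x, with both sides moved so that no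
  -- subtraction occurs.
  factor : ∀ {n f} → Monic (suc n) f → ∀ a →
           ∃[ g ] Monic n g × (∀ x → f x + a * g x ≈ x * g x + f a)
  factor {f = f} (shift {g = p} (one p≈1) c f≈) a = (λ _ → 1#) , one (λ _ → refl) , λ x → begin
    f x + a * 1#                ≈⟨ +-congʳ (f≈ x) ⟩
    (x * p x + c) + a * 1#      ≈⟨ +-congʳ (+-congʳ (*-congˡ (p≈1 x))) ⟩
    (x * 1# + c) + a * 1#       ≈⟨ solve 4 (λ x c a e → (x :* e :+ c) :+ a :* e := x :* e :+ (a :* e :+ c)) refl x c a 1# ⟩
    x * 1# + (a * 1# + c)       ≈⟨ +-congˡ (+-congʳ (*-congˡ (p≈1 a))) ⟨
    x * 1# + (a * p a + c)      ≈⟨ +-congˡ (f≈ a) ⟨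
    x * 1# + f a                ∎
  factor {f = f} (shift {g = p} p-monic@(shift _ _ _) c f≈) a with factor p-monic a
  -- Synthetic division: for f = x p + c and p - p(a) = (x - a) g, the quotient of f - f(a) by x - a
  -- is x g + p(a).
  ... | g , g-monic , p≈ = (λ x → x * g x + p a) , shift g-monic (p a) (λ _ → refl) , λ x → begin
    f x + a * (x * g x + p a)                ≈⟨ +-congʳ (f≈ x) ⟩
    (x * p x + c) + a * (x * g x + p a)      ≈⟨ solve 6 (λ x y c a u v → (x :* y :+ c) :+ a :* (x :* u :+ v) := x :* (y :+ a :* u) :+ (a :* v :+ c)) refl x (p x) c a (g x) (p a) ⟩
    x * (p x + a * g x) + (a * p a + c)      ≈⟨ +-cong (*-congˡ (p≈ x)) (sym (f≈ a)) ⟩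
    x * (x * g x + p a) + f a                ∎

  module _ (1≉0 : ¬ (1# ≈ 0#)) (noZeroDivisors : ∀ {x y} → x * y ≈ 0# → x ≈ 0# ⊎ y ≈ 0#) where

    -- Splitting off the root numbered 0 leaves a quotient of lower degree. The other roots differ
    -- from that one, so, without zero divisors, they are roots of the quotient; in degree 0 the
    -- constant 1 would have to vanish.
    monic-root-bound : ∀ {n f} → Monic n f → (root : Fin (suc n) → Carrier) →
                       (∀ i j → root i ≈ root j → i ≡ j) →
                       ¬ (∀ i → f (root i) ≈ 0#)
    monic-root-bound (one f≈1) root _ f≈0 = 1≉0 (trans (sym (f≈1 (root 0F))) (f≈0 0F))
    monic-root-bound {f = f} p@(shift _ _ _) root root-inj f≈0 with factor p (root 0F)
    ... | g , g-monic , f≈ = monic-root-bound g-monic (root ∘ Fin.suc)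
        (λ i j eq → Fin.suc-injective (root-inj _ _ eq)) g≈0
      where
      g≈0 : ∀ i → g (root (Fin.suc i)) ≈ 0#
      g≈0 i = [ (λ x-a≈0 → contradiction (root-inj _ _ (x∙y⁻¹≈ε⇒x≈y x a x-a≈0)) λ ()) , id ]′
        (noZeroDivisors (begin
          (x - a) * g x              ≈⟨ [y-z]x≈yx-zx (g x) x a ⟩
          x * g x - a * g x          ≈⟨ +-congʳ (+-identityʳ (x * g x)) ⟨
          x * g x + 0# - a * g x     ≈⟨ +-congʳ (+-congˡ (f≈0 0F)) ⟨
          x * g x + f a - a * g x    ≈⟨ +-congʳ (f≈ x) ⟨
          f x + a * g x - a * g x    ≈⟨ +-congʳ (+-congʳ (f≈0 (Fin.suc i))) ⟩
          0# + a * g x - a * g x     ≈⟨ +-congʳ (+-identityˡ (a * g x)) ⟩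
          a * g x - a * g x          ≈⟨ -‿inverseʳ (a * g x) ⟩
          0#                         ∎))
        where
        x a : Carrier
        x = root (Fin.suc i)
        a = root 0F

-- Finite fields: decidability, characteristic, and the identity x^q = x.

module FiniteField {c ℓ₁ ℓ₂} (F : HeytingField c ℓ₁ ℓ₂) (q : ℕ)
                   (card : OverField.HasCardinality F q) where

  open HeytingField F using (_#_; tight; #⇒invertible; heytingCommutativeRing)
  open OverField F using (commutativeRing)
  open CommutativeRing commutativeRing
  open HeytingProperties heytingCommutativeRing
  open RingProperties ring
  open Exp semiring using (_^_)
  open Mult semiring using (×1-homo-*) renaming (_×_ to _·_)
  open Inverse card using (to; from; to-cong; strictlyInverseˡ; strictlyInverseʳ)
  open MonicPolynomials commutativeRing using (Monic; monic-root-bound)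
  open ≈-Reasoning setoid

  private
    module ∑ = Sum +-commutativeMonoid
    module ∏ = Sum *-commutativeMonoid

  infix 4 _≈?_

  from-injective : ∀ {i j} → from i ≈ from j → i ≡ j
  from-injective {i} {j} eq =
    ≡.trans (≡.sym (strictlyInverseˡ i)) (≡.trans (to-cong eq) (strictlyInverseˡ j))

  to-injective : ∀ {x y} → to x ≡ to y → x ≈ y
  to-injective {x} {y} eq =
    trans (sym (strictlyInverseʳ x)) (trans (reflexive (≡.cong from eq)) (strictlyInverseʳ y))

  _≈?_ : Decidable _≈_
  x ≈? y = map′ to-injective to-cong (to x Fin.≟ to y)

  1≉0 : ¬ (1# ≈ 0#)
  1≉0 1≈0 = proj₂ (tight 1# 0#) 1≈0 1#0

  #0-inverse : ∀ {x} → x # 0# → ∃[ y ] x * y ≈ 1#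
  #0-inverse {x} x#0 with #⇒invertible x#0
  ... | y , _ , xy≈1 = y , trans (*-congʳ (sym (x-0≈x x))) xy≈1

  -- Tightness only turns a refuted apartness into an equality. The missing direction comes from
  -- finiteness: being invertible is decidable by trying all q candidates, and invertibility is
  -- equivalent to apartness from zero.
  ≉0⇒#0 : ∀ {x} → ¬ (x ≈ 0#) → x # 0#
  ≉0⇒#0 {x} x≉0 with Fin.any? (λ i → x * from i ≈? 1#)
  ... | yes (i , xy≈1) = invertibleʳ⇒# (from i , trans (*-congʳ (x-0≈x x)) xy≈1)
  ... | no  ¬inv       = contradiction (proj₁ (tight x 0#) ¬x#0) x≉0
    where
    ¬x#0 : ¬ (x # 0#)
    ¬x#0 x#0 with #0-inverse x#0
    ... | y , xy≈1 = ¬inv (to y , trans (*-congˡ (strictlyInverseʳ y)) xy≈1)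

  #0⇒cancel : ∀ {x y} → x # 0# → x * y ≈ 0# → y ≈ 0#
  #0⇒cancel {x} {y} x#0 xy≈0 with #0-inverse x#0
  ... | w , xw≈1 = begin
    y            ≈⟨ *-identityˡ y ⟨
    1# * y       ≈⟨ *-congʳ (trans (*-comm w x) xw≈1) ⟨
    w * x * y    ≈⟨ *-assoc w x y ⟩
    w * (x * y)  ≈⟨ *-congˡ xy≈0 ⟩
    w * 0#       ≈⟨ zeroʳ w ⟩
    0#           ∎

  noZeroDivisors : ∀ {x y} → x * y ≈ 0# → x ≈ 0# ⊎ y ≈ 0#
  noZeroDivisors {x} xy≈0 with x ≈? 0#
  ... | yes x≈0 = inj₁ x≈0
  ... | no  x≉0 = inj₂ (#0⇒cancel (≉0⇒#0 x≉0) xy≈0)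

  permutation : (σ τ : Carrier → Carrier) →
                (∀ {x y} → x ≈ y → σ x ≈ σ y) → (∀ {x y} → x ≈ y → τ x ≈ τ y) →
                (∀ x → σ (τ x) ≈ x) → (∀ x → τ (σ x) ≈ x) → Perm.Permutation q q
  permutation σ τ σ-cong τ-cong στ τσ = Perm.permutation (to ∘ σ ∘ from) (to ∘ τ ∘ from)
    (λ i → ≡.trans (to-cong (trans (σ-cong (strictlyInverseʳ _)) (στ (from i)))) (strictlyInverseˡ i))
    (λ i → ≡.trans (to-cong (trans (τ-cong (strictlyInverseʳ _)) (τσ (from i)))) (strictlyInverseˡ i))

  -- Translation by 1 permutes the field, so Σ x = Σ (x + 1) = Σ x + q.
  q·1≈0 : q · 1# ≈ 0#
  q·1≈0 = begin
    q · 1#                                        ≈⟨ ∑.sum-replicate q ⟨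
    ∑.sum {q} (λ _ → 1#)                          ≈⟨ +-identityˡ _ ⟨
    0# + ∑.sum {q} (λ _ → 1#)                     ≈⟨ +-congʳ (-‿inverseˡ _) ⟨
    - ∑.sum from + ∑.sum from + ∑.sum {q} (λ _ → 1#)  ≈⟨ +-assoc _ _ _ ⟩
    - ∑.sum from + (∑.sum from + ∑.sum {q} (λ _ → 1#))  ≈⟨ +-congˡ (∑.∑-distrib-+ from (λ _ → 1#)) ⟨
    - ∑.sum from + ∑.sum (λ i → from i + 1#)      ≈⟨ +-congˡ (∑.sum-cong-≋ (λ i → strictlyInverseʳ (from i + 1#))) ⟨
    - ∑.sum from + ∑.sum (λ i → from (to (from i + 1#)))  ≈⟨ +-congˡ (∑.sum-permute from translation) ⟨
    - ∑.sum from + ∑.sum from                     ≈⟨ -‿inverseˡ _ ⟩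
    0#                                            ∎
    where
    translation : Perm.Permutation q q
    translation = permutation (_+ 1#) (_- 1#) +-congʳ +-congʳ
      (λ x → trans (+-assoc x (- 1#) 1#) (trans (+-congˡ (-‿inverseˡ 1#)) (+-identityʳ x)))
      (λ x → trans (+-assoc x 1# (- 1#)) (trans (+-congˡ (-‿inverseʳ 1#)) (+-identityʳ x)))

  -- The multiple of 1 by a power of p is a power of the multiple by p, so one factor must vanish;
  -- exponent 0 would give 1 = 0.
  prime-power⇒p·1≈0 : ∀ p d → (p ^ℕ d) · 1# ≈ 0# → p · 1# ≈ 0#
  prime-power⇒p·1≈0 p zero    eq = contradiction (trans (sym (+-identityʳ 1#)) eq) 1≉0
  prime-power⇒p·1≈0 p (suc d) eq =
    [ id , prime-power⇒p·1≈0 p d ]′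
      (noZeroDivisors (trans (sym (×1-homo-* p (p ^ℕ d))) eq))

  product#0 : ∀ {n} (t : Vector Carrier n) → (∀ i → t i # 0#) → ∏.sum t # 0#
  product#0 {zero}  t _   = 1#0
  product#0 {suc n} t t#0 = x#0y#0→xy#0 (t#0 0F) (product#0 (t ∘ Fin.suc) (t#0 ∘ Fin.suc))

  -- Lets a product over the nonzero elements run over all indices of `Fin q`: the value at zero is
  -- replaced by a prescribed factor.
  choose : Carrier → Carrier → Carrier → Carrier
  choose a b y with y ≈? 0#
  ... | yes _ = b
  ... | no  _ = a

  choose-≈0 : ∀ a b {y} → y ≈ 0# → choose a b y ≈ b
  choose-≈0 a b {y} y≈0 with y ≈? 0#
  ... | yes _   = refl
  ... | no  y≉0 = contradiction y≈0 y≉0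

  choose-≉0 : ∀ a b {y} → ¬ (y ≈ 0#) → choose a b y ≈ a
  choose-≉0 a b {y} y≉0 with y ≈? 0#
  ... | yes y≈0 = contradiction y≈0 y≉0
  ... | no  _   = refl

  -- Multiplication by x ≠ 0 permutes the field, so the product P of the nonzero
  -- elements satisfies P = x^(q-1) P.
  x^q≈x : ∀ x → x ^ q ≈ x
  x^q≈x x with x ≈? 0#
  x^q≈x x | yes x≈0 = xⁿ≈x q ≡.refl
    where
    xⁿ≈x : ∀ n → n ≡ q → x ^ n ≈ x
    -- At zero the identity needs a positive exponent; `to 0#` inhabits `Fin q`, which excludes q =
    -- 0.
    xⁿ≈x zero    ≡.refl = contradiction (to 0#) λ ()
    xⁿ≈x (suc n) _      = trans (*-congʳ x≈0) (trans (zeroˡ _) (sym x≈0))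
  x^q≈x x | no x≉0 = begin
    x ^ q                              ≈⟨ ∏.sum-replicate q ⟨
    ∏.sum {q} (λ _ → x)                ≈⟨ ∏.sum-cong-≋ split ⟩
    ∏.sum (λ i → g (from i) * e (from i))  ≈⟨ ∏.∑-distrib-+ (g ∘ from) (e ∘ from) ⟩
    G * ∏.sum (e ∘ from)               ≈⟨ *-cong G≈1 ∏e≈x ⟩
    1# * x                             ≈⟨ *-identityˡ x ⟩
    x                                  ∎
    where
    x#0 : x # 0#
    x#0 = ≉0⇒#0 x≉0

    w : Carrier
    w = proj₁ (#0-inverse x#0)

    xw≈1 : x * w ≈ 1#
    xw≈1 = proj₂ (#0-inverse x#0)

    -- `g` is x except for a 1 at zero, `e` is 1 except for an x at zero, and `h` is the identity
    -- except for a 1 at zero. Thus `G` is x^(q-1), the product of all `e` is the one remaining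
    -- factor x, and `P` is the product of the nonzero elements.
    g e h : Carrier → Carrier
    g = choose x 1#
    e = choose 1# x
    h y = choose y 1# y

    G P : Carrier
    G = ∏.sum (g ∘ from)
    P = ∏.sum (h ∘ from)

    split : ∀ i → x ≈ g (from i) * e (from i)
    split i with from i ≈? 0#
    ... | yes _ = sym (*-identityˡ x)
    ... | no  _ = sym (*-identityʳ x)

    ∏e≈x : ∏.sum (e ∘ from) ≈ x
    ∏e≈x = trans
      (sum-single *-commutativeMonoid (to 0#) (e ∘ from)
        (λ j j≢ → choose-≉0 1# x (λ eq → j≢ (from-injective (trans eq (sym (strictlyInverseʳ 0#)))))))
      (choose-≈0 1# x (strictlyInverseʳ 0#))

    h#0 : ∀ y → h y # 0#
    h#0 y with y ≈? 0#
    ... | yes _   = 1#0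
    ... | no  y≉0 = ≉0⇒#0 y≉0

    h-cong : ∀ {y z} → y ≈ z → h y ≈ h z
    h-cong {y} {z} y≈z with y ≈? 0# | z ≈? 0#
    ... | yes _   | yes _   = refl
    ... | no  _   | no  _   = y≈z
    ... | yes y≈0 | no  z≉0 = contradiction (trans (sym y≈z) y≈0) z≉0
    ... | no  y≉0 | yes z≈0 = contradiction (trans y≈z z≈0) y≉0

    h-scale : ∀ y → h (x * y) ≈ g y * h y
    h-scale y with y ≈? 0#
    ... | yes y≈0 = trans (choose-≈0 (x * y) 1# (trans (*-congˡ y≈0) (zeroʳ x))) (sym (*-identityˡ 1#))
    ... | no  y≉0 = choose-≉0 (x * y) 1# (y≉0 ∘ #0⇒cancel x#0)

    scaling : Perm.Permutation q q
    scaling = permutation (x *_) (w *_) *-congˡ *-congˡ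
      (λ y → trans (sym (*-assoc x w y)) (trans (*-congʳ xw≈1) (*-identityˡ y)))
      (λ y → trans (sym (*-assoc w x y)) (trans (*-congʳ (trans (*-comm w x) xw≈1)) (*-identityˡ y)))

    P≈GP : P ≈ G * P
    P≈GP = begin
      P                                        ≈⟨ ∏.sum-permute (h ∘ from) scaling ⟩
      ∏.sum (λ i → h (from (to (x * from i)))) ≈⟨ ∏.sum-cong-≋ (λ i → h-cong (strictlyInverseʳ (x * from i))) ⟩
      ∏.sum (λ i → h (x * from i))             ≈⟨ ∏.sum-cong-≋ (λ i → h-scale (from i)) ⟩
      ∏.sum (λ i → g (from i) * h (from i))    ≈⟨ ∏.∑-distrib-+ (g ∘ from) (h ∘ from) ⟩
      G * P                                    ∎

    G≈1 : G ≈ 1#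
    G≈1 = x∙y⁻¹≈ε⇒x≈y G 1# (#0⇒cancel (product#0 (h ∘ from) (h#0 ∘ from)) (begin
      P * (G - 1#)      ≈⟨ *-comm P (G - 1#) ⟩
      (G - 1#) * P      ≈⟨ [y-z]x≈yx-zx P G 1# ⟩
      G * P - 1# * P    ≈⟨ +-cong (sym P≈GP) (-‿cong (*-identityˡ P)) ⟩
      P - P             ≈⟨ -‿inverseʳ P ⟩
      0#                ∎))

  -- If the search through the field fails, every element is a root, and n + 1 ≤ q of them, taken
  -- along `inject≤`, already exceed the root bound.
  monic-nonroot : ∀ {n f} → Monic n f → n ℕ.< q → ∃[ x ] ¬ (f x ≈ 0#)
  monic-nonroot {n} {f} f-monic n<q with Fin.any? (λ i → ¬? (f (from i) ≈? 0#))
  ... | yes (i , f≉0) = from i , f≉0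
  ... | no  ¬∃        = ⊥-elim (monic-root-bound 1≉0 noZeroDivisors f-monic
    (λ i → from (inject≤ i n<q))
    (λ i j eq → Fin.inject≤-injective n<q n<q i j (from-injective eq))
    (λ i → decidable-stable (f _ ≈? 0#) (λ f≉0 → ¬∃ (inject≤ i n<q , f≉0))))

-- Ring identities in characteristic 3.

data 𝔽₃ : Set where
  zer pos neg : 𝔽₃

𝔽₃-rawRing : RawRing Level.zero Level.zero
𝔽₃-rawRing = record
  { Carrier = 𝔽₃ ; _≈_ = _≡_ ; _+_ = _+_ ; _*_ = _*_ ; -_ = -_ ; 0# = zer ; 1# = pos }
  where
  infixl 6 _+_
  infixl 7 _*_
  infix  8 -_

  _+_ _*_ : 𝔽₃ → 𝔽₃ → 𝔽₃
  zer + y   = y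
  pos + zer = pos
  pos + pos = neg
  pos + neg = zer
  neg + zer = neg
  neg + pos = zer
  neg + neg = pos

  -_ : 𝔽₃ → 𝔽₃
  - zer = zer
  - pos = neg
  - neg = pos

  zer * y = zer
  pos * y = y
  neg * y = - y

-- With coefficients in 𝔽₃, the solver also proves identities that hold only in
-- characteristic 3, such as (x + y)³ = x³ + y³.
module Characteristic3 {c ℓ} (R : CommutativeRing c ℓ) where

  open CommutativeRing R
  open RingProperties ring
  open RawRing 𝔽₃-rawRing using () renaming (_+_ to _+₃_; _*_ to _*₃_; -_ to -₃_)

  module Solver (1+1+1≈0 : 1# + (1# + 1#) ≈ 0#) where

    ⟦_⟧₃ : 𝔽₃ → Carrier
    ⟦ zer ⟧₃ = 0#
    ⟦ pos ⟧₃ = 1#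
    ⟦ neg ⟧₃ = - 1#

    1+1≈-1 : 1# + 1# ≈ - 1#
    1+1≈-1 = +-inverseʳ-unique 1# (1# + 1#) 1+1+1≈0

    -homo : ∀ x → ⟦ -₃ x ⟧₃ ≈ - ⟦ x ⟧₃
    -homo zer = sym -0#≈0#
    -homo pos = refl
    -homo neg = sym (-‿involutive 1#)

    +homo : ∀ x y → ⟦ x +₃ y ⟧₃ ≈ ⟦ x ⟧₃ + ⟦ y ⟧₃
    +homo zer y   = sym (+-identityˡ ⟦ y ⟧₃)
    +homo pos zer = sym (+-identityʳ 1#)
    +homo pos pos = sym 1+1≈-1
    +homo pos neg = sym (-‿inverseʳ 1#)
    +homo neg zer = sym (+-identityʳ (- 1#))
    +homo neg pos = sym (-‿inverseˡ 1#)
    +homo neg neg = trans (sym (-‿involutive 1#))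
      (trans (-‿cong (sym 1+1≈-1)) (-‿anti-homo-+ 1# 1#))

    *homo : ∀ x y → ⟦ x *₃ y ⟧₃ ≈ ⟦ x ⟧₃ * ⟦ y ⟧₃
    *homo zer y = sym (zeroˡ ⟦ y ⟧₃)
    *homo pos y = sym (*-identityˡ ⟦ y ⟧₃)
    *homo neg y = trans (-homo y) (sym (-1*x≈-x ⟦ y ⟧₃))

    morphism : 𝔽₃-rawRing -Raw-AlmostCommutative⟶ fromCommutativeRing R
    morphism = record
      { ⟦_⟧    = ⟦_⟧₃
      ; +-homo = +homo
      ; *-homo = *homo
      ; -‿homo = -homo
      ; 0-homo = refl
      ; 1-homo = refl
      }

    _coeff≟_ : WeaklyDecidable (Induced-equivalence morphism)
    zer coeff≟ zer = just refl
    pos coeff≟ pos = just refl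
    neg coeff≟ neg = just refl
    _   coeff≟ _   = nothing

    open RingSolver 𝔽₃-rawRing (fromCommutativeRing R) morphism _coeff≟_ public
      using (solve; _:=_; _:+_; _:*_; _:-_; :-_; _:^_; _:×_; con; Polynomial)

module FiniteFieldOfCharacteristic3 {c ℓ₁ ℓ₂} (F : HeytingField c ℓ₁ ℓ₂) (d : ℕ)
                                    (card : OverField.HasCardinality F (3 ^ℕ d)) where

  open HeytingField F using (_#_; #⇒invertible; heytingCommutativeRing)
  open OverField F
  open CommutativeRing commutativeRing
  open HeytingProperties heytingCommutativeRing
  open RingProperties ring
  open Exp semiring using (^-congˡ; ^-congʳ; ^-assocʳ)
  open FiniteField F (3 ^ℕ d) card
  open MonicPolynomials commutativeRing using (Monic; shift; power)
  open ≈-Reasoning setoid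

  1+1+1≈0 : 1# + (1# + 1#) ≈ 0#
  1+1+1≈0 = trans (+-congˡ (+-congˡ (sym (+-identityʳ 1#)))) (prime-power⇒p·1≈0 3 d q·1≈0)

  open Characteristic3.Solver commutativeRing 1+1+1≈0

  private
    :0 :1 : ∀ {n} → Polynomial n
    :0 = con zer
    :1 = con pos

  x≈±y : ∀ {x y} → x ^ 2 ≈ y ^ 2 → x ≈ y ⊎ x ≈ - y
  x≈±y {x} {y} eq =
    [ inj₁ ∘ x∙y⁻¹≈ε⇒x≈y x y , inj₂ ∘ +-inverseˡ-unique x y ]′ (noZeroDivisors (begin
      (x - y) * (x + y)  ≈⟨ solve 2 (λ x y → (x :- y) :* (x :+ y) := x :^ 2 :- y :^ 2) refl x y ⟩
      x ^ 2 - y ^ 2      ≈⟨ +-congʳ eq ⟩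
      y ^ 2 - y ^ 2      ≈⟨ -‿inverseʳ (y ^ 2) ⟩
      0#                 ∎))

  x≈-x⇒x≈0 : ∀ {x} → x ≈ - x → x ≈ 0#
  x≈-x⇒x≈0 {x} eq = begin
    x            ≈⟨ solve 1 (λ x → x := :- (x :+ x)) refl x ⟩
    - (x + x)    ≈⟨ -‿cong (+-congʳ eq) ⟩
    - (- x + x)  ≈⟨ solve 1 (λ x → :- (:- x :+ x) := :0) refl x ⟩
    0#           ∎

  1≉-1 : ¬ (1# ≈ - 1#)
  1≉-1 = 1≉0 ∘ x≈-x⇒x≈0

  0≉-1 : ¬ (0# ≈ - 1#)
  0≉-1 0≈-1 = 1≉0 (trans (sym (-‿involutive 1#)) (trans (-‿cong (sym 0≈-1)) -0#≈0#))

  -- Powers of Frobenius, partial traces, and the values of the trace.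

  frob : ℕ → Carrier → Carrier
  frob n x = x ^ (3 ^ℕ n)

  frob-suc : ∀ n x → frob n x ^ 3 ≈ frob (suc n) x
  frob-suc n x = trans (^-assocʳ x (3 ^ℕ n) 3) (^-congʳ x (ℕ.*-comm (3 ^ℕ n) 3))

  frob-+ : ∀ n x y → frob n (x + y) ≈ frob n x + frob n y
  frob-+ zero    x y = solve 2 (λ x y → (x :+ y) :^ 1 := x :^ 1 :+ y :^ 1) refl x y
  frob-+ (suc n) x y = begin
    frob (suc n) (x + y)             ≈⟨ frob-suc n (x + y) ⟨
    frob n (x + y) ^ 3               ≈⟨ ^-congˡ 3 (frob-+ n x y) ⟩
    (frob n x + frob n y) ^ 3        ≈⟨ solve 2 (λ x y → (x :+ y) :^ 3 := x :^ 3 :+ y :^ 3) refl (frob n x) (frob n y) ⟩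
    frob n x ^ 3 + frob n y ^ 3      ≈⟨ +-cong (frob-suc n x) (frob-suc n y) ⟩
    frob (suc n) x + frob (suc n) y  ∎

  frob-neg : ∀ n x → frob n (- x) ≈ - frob n x
  frob-neg zero    x = solve 1 (λ x → (:- x) :^ 1 := :- (x :^ 1)) refl x
  frob-neg (suc n) x = begin
    frob (suc n) (- x)  ≈⟨ frob-suc n (- x) ⟨
    frob n (- x) ^ 3    ≈⟨ ^-congˡ 3 (frob-neg n x) ⟩
    (- frob n x) ^ 3    ≈⟨ solve 1 (λ x → (:- x) :^ 3 := :- (x :^ 3)) refl (frob n x) ⟩
    - (frob n x ^ 3)    ≈⟨ -‿cong (frob-suc n x) ⟩
    - frob (suc n) x    ∎

  trace-cong : ∀ n {x y} → x ≈ y → trace n x ≈ trace n y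
  trace-cong zero    x≈y = refl
  trace-cong (suc n) x≈y = +-cong (trace-cong n x≈y) (^-congˡ (3 ^ℕ n) x≈y)

  trace-+ : ∀ n x y → trace n (x + y) ≈ trace n x + trace n y
  trace-+ zero    x y = sym (+-identityʳ 0#)
  trace-+ (suc n) x y = begin
    trace n (x + y) + frob n (x + y)                  ≈⟨ +-cong (trace-+ n x y) (frob-+ n x y) ⟩
    (trace n x + trace n y) + (frob n x + frob n y)   ≈⟨ solve 4 (λ a b c e → (a :+ b) :+ (c :+ e) := (a :+ c) :+ (b :+ e)) refl (trace n x) (trace n y) (frob n x) (frob n y) ⟩
    trace (suc n) x + trace (suc n) y                 ∎

  trace-neg : ∀ n x → trace n (- x) ≈ - trace n x
  trace-neg zero    x = sym -0#≈0#
  trace-neg (suc n) x = begin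
    trace n (- x) + frob n (- x)  ≈⟨ +-cong (trace-neg n x) (frob-neg n x) ⟩
    - trace n x - frob n x        ≈⟨ solve 2 (λ a b → :- a :- b := :- (a :+ b)) refl (trace n x) (frob n x) ⟩
    - trace (suc n) x             ∎

  trace-- : ∀ n x y → trace n (x - y) ≈ trace n x - trace n y
  trace-- n x y = trans (trace-+ n x (- y)) (+-congˡ (trace-neg n y))

  trace-0 : ∀ n → trace n 0# ≈ 0#
  trace-0 n = begin
    trace n 0#              ≈⟨ trace-cong n (-‿inverseʳ 0#) ⟨
    trace n (0# - 0#)       ≈⟨ trace-- n 0# 0# ⟩
    trace n 0# - trace n 0# ≈⟨ -‿inverseʳ (trace n 0#) ⟩
    0#                      ∎

  -- Cubing moves each term of the partial trace one place up, and x refills the vacated initial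
  -- place. This is the recursion from the other end of the sum.
  trace-^3 : ∀ n x → trace n x ^ 3 + x ≈ trace (suc n) x
  trace-^3 zero    x = solve 1 (λ x → :0 :^ 3 :+ x := :0 :+ x :^ 1) refl x
  trace-^3 (suc n) x = begin
    (trace n x + frob n x) ^ 3 + x       ≈⟨ solve 3 (λ s f x → (s :+ f) :^ 3 :+ x := (s :^ 3 :+ x) :+ f :^ 3) refl (trace n x) (frob n x) x ⟩
    (trace n x ^ 3 + x) + frob n x ^ 3   ≈⟨ +-cong (trace-^3 n x) (frob-suc n x) ⟩
    trace (suc n) x + frob (suc n) x     ∎

  trace-telescope : ∀ n x → trace n (x ^ 3 - x) ≈ frob n x - x
  trace-telescope zero    x = solve 1 (λ x → :0 := x :^ 1 :- x) refl x
  trace-telescope (suc n) x = begin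
    trace n (x ^ 3 - x) + frob n (x ^ 3 - x)
      ≈⟨ +-cong (trace-telescope n x) (trans (frob-+ n (x ^ 3) (- x)) (+-cong (^-assocʳ x 3 (3 ^ℕ n)) (frob-neg n x))) ⟩
    (frob n x - x) + (frob (suc n) x - frob n x)
      ≈⟨ solve 3 (λ x f f′ → (f :- x) :+ (f′ :- f) := f′ :- x) refl x (frob n x) (frob (suc n) x) ⟩
    frob (suc n) x - x
      ∎

  Tr : Carrier → Carrier
  Tr = trace d

  Tr-x³-x : ∀ x → Tr (x ^ 3 - x) ≈ 0#
  Tr-x³-x x = trans (trace-telescope d x) (trans (+-congʳ (x^q≈x x)) (-‿inverseʳ x))

  data TraceValue (x : Carrier) : Set ℓ₁ where
    Tr≈0  : Tr x ≈ 0#   → TraceValue x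
    Tr≈1  : Tr x ≈ 1#   → TraceValue x
    Tr≈-1 : Tr x ≈ - 1# → TraceValue x

  -- For n = d, `trace-^3` together with x^q = x gives t³ = t for t = Tr x, so t is a root of T(T -
  -- 1)(T + 1).
  traceValue : ∀ x → TraceValue x
  traceValue x =
    [ Tr≈0 , [ Tr≈1 ∘ x∙y⁻¹≈ε⇒x≈y (Tr x) 1# , Tr≈-1 ∘ +-inverseˡ-unique (Tr x) 1# ]′ ∘ noZeroDivisors ]′
      (noZeroDivisors (begin
        Tr x * ((Tr x - 1#) * (Tr x + 1#))  ≈⟨ solve 2 (λ t x → t :* ((t :- :1) :* (t :+ :1)) := (t :^ 3 :+ x) :- (t :+ x)) refl (Tr x) x ⟩
        (Tr x ^ 3 + x) - (Tr x + x)         ≈⟨ +-congʳ (trace-^3 d x) ⟩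
        (Tr x + x ^ (3 ^ℕ d)) - (Tr x + x)  ≈⟨ +-congʳ (+-congˡ (x^q≈x x)) ⟩
        (Tr x + x) - (Tr x + x)             ≈⟨ -‿inverseʳ (Tr x + x) ⟩
        0#                                  ∎))

  -- Additive Hilbert 90.

  -- The explicit cochain of the additive form of Hilbert 90:
  -- β = Σ_{i<n} (b + b³ + … + b^(3^(i-1))) θ^(3^i).
  hilbert90 : Carrier → Carrier → ℕ → Carrier
  hilbert90 θ b zero    = 0#
  hilbert90 θ b (suc n) = hilbert90 θ b n + trace n b * frob n θ

  -- The partial traces S_i of b satisfy S_i³ = S_(i+1) - b. Cubing β therefore shifts its index by
  -- one, at the cost of b times the conjugates θ³, θ⁹, ..., θ^(3^n); these are moved to the left,
  -- completed by θ itself.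
  hilbert90-^3 : ∀ θ b n →
    hilbert90 θ b n ^ 3 + b * (trace n θ + frob n θ) ≈
    hilbert90 θ b n + trace n b * frob n θ + b * θ
  hilbert90-^3 θ b zero = solve 2
    (λ θ b → :0 :^ 3 :+ b :* (:0 :+ θ :^ 1) := :0 :+ :0 :* θ :^ 1 :+ b :* θ) refl θ b
  hilbert90-^3 θ b (suc n) = begin
    (β + S * t) ^ 3 + b * ((T + t) + t′)
      ≈⟨ +-congˡ (*-congˡ (+-congˡ (sym (frob-suc n θ)))) ⟩
    (β + S * t) ^ 3 + b * ((T + t) + t ^ 3)
      ≈⟨ solve 5 (λ β S t b T → (β :+ S :* t) :^ 3 :+ b :* ((T :+ t) :+ t :^ 3) :=
           (β :^ 3 :+ b :* (T :+ t)) :+ (S :^ 3 :+ b) :* t :^ 3) refl β S t b T ⟩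
    (β ^ 3 + b * (T + t)) + (S ^ 3 + b) * t ^ 3
      ≈⟨ +-cong (hilbert90-^3 θ b n) (*-cong (trace-^3 n b) (frob-suc n θ)) ⟩
    (β + S * t + b * θ) + S′ * t′
      ≈⟨ solve 3 (λ x y z → x :+ y :+ z := x :+ z :+ y) refl (β + S * t) (b * θ) (S′ * t′) ⟩
    β + S * t + S′ * t′ + b * θ
      ∎
    where
    β S S′ T t t′ : Carrier
    β  = hilbert90 θ b n
    S  = trace n b
    S′ = trace (suc n) b
    T  = trace n θ
    t  = frob n θ
    t′ = frob (suc n) θ

  artin-schreier : ∀ {θ b} → Tr θ ≈ 1# → Tr b ≈ 0# → ∃[ r ] r ^ 3 - r ≈ b
  -- For n = d the shifted term dies with Tr b, and Tr θ = 1 and θ^q = θ reduce the recursion to β³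
  -- - β = -b; hence the sign of the witness.
  artin-schreier {θ} {b} Trθ≈1 Trb≈0 = - β , (begin
    (- β) ^ 3 - (- β)
      ≈⟨ solve 3 (λ β b θ → (:- β) :^ 3 :- (:- β) :=
           (β :+ :0 :* θ :+ b :* θ) :+ b :- (β :^ 3 :+ b :* (:1 :+ θ))) refl β b θ ⟩
    (β + 0# * θ + b * θ) + b - (β ^ 3 + b * (1# + θ))
      ≈⟨ +-congʳ (+-congʳ (+-congʳ (+-congˡ (*-cong Trb≈0 (x^q≈x θ))))) ⟨
    (β + Tr b * frob d θ + b * θ) + b - (β ^ 3 + b * (1# + θ))
      ≈⟨ +-congʳ (+-congʳ (hilbert90-^3 θ b d)) ⟨
    (β ^ 3 + b * (Tr θ + frob d θ)) + b - (β ^ 3 + b * (1# + θ))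
      ≈⟨ +-congʳ (+-congʳ (+-congˡ (*-congˡ (+-cong Trθ≈1 (x^q≈x θ))))) ⟩
    (β ^ 3 + b * (1# + θ)) + b - (β ^ 3 + b * (1# + θ))
      ≈⟨ solve 2 (λ x b → x :+ b :- x := b) refl (β ^ 3 + b * (1# + θ)) b ⟩
    b
      ∎)
    where
    β : Carrier
    β = hilbert90 θ b d

  -- Square roots of -1 and the parity of d.

  -- Since i³ = -i, cubing alternates between i and -i, so the induction advances by two.
  frob-√-1 : ∀ {i} → i ^ 2 ≈ - 1# → ∀ n → 2 ∣ n ⊎ frob n i ≈ - i
  frob-√-1 {i} i²≈-1 = go
    where
    i³≈-i : i ^ 3 ≈ - i
    i³≈-i = trans (*-congˡ i²≈-1) (trans (*-comm i (- 1#)) (-1*x≈-x i))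

    go : ∀ n → 2 ∣ n ⊎ frob n i ≈ - i
    go 0             = inj₁ (divides 0 ≡.refl)
    go 1             = inj₂ i³≈-i
    go (suc (suc n)) with go n
    ... | inj₁ (divides k n≡k*2) = inj₁ (divides (suc k) (≡.cong (2 ℕ.+_) n≡k*2))
    ... | inj₂ fⁿi≈-i = inj₂ (begin
      frob (2 ℕ.+ n) i  ≈⟨ trans (sym (frob-suc (suc n) i)) (^-congˡ 3 (sym (frob-suc n i))) ⟩
      (frob n i ^ 3) ^ 3    ≈⟨ ^-congˡ 3 (^-congˡ 3 fⁿi≈-i) ⟩
      ((- i) ^ 3) ^ 3       ≈⟨ solve 1 (λ i → ((:- i) :^ 3) :^ 3 := :- (i :^ 3) :^ 3) refl i ⟩
      - (i ^ 3) ^ 3         ≈⟨ -‿cong (^-congˡ 3 i³≈-i) ⟩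
      - (- i) ^ 3           ≈⟨ solve 1 (λ i → :- (:- i) :^ 3 := i :^ 3) refl i ⟩
      i ^ 3                 ≈⟨ i³≈-i ⟩
      - i                   ∎)

  -- A square root i would satisfy both i^q = i and i^q = -i, hence i = 0, against i² = -1.
  -1-nonSquare : 2 ∤ d → NonSquare (- 1#)
  -1-nonSquare 2∤d (i , -1≈i²) with frob-√-1 (sym -1≈i²) d
  ... | inj₁ 2∣d  = 2∤d 2∣d
  ... | inj₂ eq = 0≉-1 (begin
    0#      ≈⟨ zeroˡ (i * 1#) ⟨
    0# * (i * 1#)  ≈⟨ *-congʳ (x≈-x⇒x≈0 (trans (sym (x^q≈x i)) eq)) ⟨
    i ^ 2   ≈⟨ -1≈i² ⟨
    - 1#    ∎)

  -- Powers of 9 are 1 modulo 4. The cofactor is written `suc k` because (q-1)/4 must be positive,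
  -- both for the polynomial in `√-1` to be monic of the claimed degree and for that degree to lie
  -- below q.
  3^2[1+e]≡1+4k : ∀ e → ∃[ k ] 3 ^ℕ (suc e ℕ.* 2) ≡ suc (suc k ℕ.* 4)
  3^2[1+e]≡1+4k zero = 1 , ≡.refl
  3^2[1+e]≡1+4k (suc e) with 3^2[1+e]≡1+4k e
  -- From 9(1 + 4(k + 1)) = 1 + 4(9k + 11).
  ... | k , eq = 9 ℕ.* k ℕ.+ 10 , ≡.trans (≡.cong (λ n → 3 ℕ.* (3 ℕ.* n)) eq) (nine k)
    where
    nine : ∀ k → 3 ℕ.* (3 ℕ.* suc (suc k ℕ.* 4)) ≡ suc (suc (9 ℕ.* k ℕ.+ 10) ℕ.* 4)
    nine = ℕ-Solver.solve-∀

  -- The polynomial x (x^((q-1)/2) - 1) has degree below q, hence a nonroot x, and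
  -- x^(q-1) = 1 leaves x^((q-1)/2) = -1 with (q-1)/2 even.
  √-1 : 1 ≤ d → 2 ∣ d → ∃[ i ] i ^ 2 ≈ - 1#
  √-1 1≤d (divides zero    d≡0) = contradiction (≡.subst (1 ≤_) d≡0 1≤d) λ ()
  √-1 1≤d (divides (suc e) d≡) with 3^2[1+e]≡1+4k e
  ... | j , 3^d≡ = x ^ k , +-inverseˡ-unique ((x ^ k) ^ 2) 1#
      ([ (λ eq → contradiction (trans (*-congˡ (+-congʳ (sym (^-assocʳ x k 2)))) eq) x-nonroot) , id ]′
        (noZeroDivisors (begin
          x * (y ^ 2 - 1#) * (y ^ 2 + 1#)  ≈⟨ solve 2 (λ x y → x :* (y :^ 2 :- :1) :* (y :^ 2 :+ :1) := x :* y :^ 4 :- x) refl x y ⟩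
          x * y ^ 4 - x                    ≈⟨ +-congʳ (*-congˡ (^-assocʳ x k 4)) ⟩
          x ^ suc (k ℕ.* 4) - x            ≈⟨ +-congʳ (^-congʳ x q≡) ⟨
          x ^ (3 ^ℕ d) - x                 ≈⟨ +-congʳ (x^q≈x x) ⟩
          x - x                            ≈⟨ -‿inverseʳ x ⟩
          0#                               ∎)))
    where
    k : ℕ
    k = suc j

    q≡ : 3 ^ℕ d ≡ suc (k ℕ.* 4)
    q≡ = ≡.trans (≡.cong (3 ^ℕ_) d≡) 3^d≡

    f-monic : Monic (suc (k ℕ.* 2)) (λ x → x * (x ^ (k ℕ.* 2) - 1#))
    f-monic = shift (shift (power (suc (j ℕ.* 2))) (- 1#) (λ _ → refl)) 0# (λ _ → sym (+-identityʳ _))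

    nonroot : ∃[ x ] ¬ (x * (x ^ (k ℕ.* 2) - 1#) ≈ 0#)
    nonroot = monic-nonroot f-monic (≡.subst (suc (k ℕ.* 2) ℕ.<_) (≡.sym q≡)
      (s≤s (ℕ.*-monoʳ-< k (s≤s (s≤s (s≤s z≤n))))))

    x y : Carrier
    x = proj₁ nonroot
    y = x ^ k

    x-nonroot : ¬ (x * (x ^ (k ℕ.* 2) - 1#) ≈ 0#)
    x-nonroot = proj₂ nonroot

  -- Isomorphisms between short Weierstrass equations.

  short-≅ : ∀ {a c a′ c′} (u r : Carrier) → u # 0# →
            u ^ 4 * a′ ≈ a → u ^ 6 * c′ ≈ c + r * a + r ^ 3 →
            short a c ≅ short a′ c′
  short-≅ {a} {c} u r u#0 u⁴a′≈a u⁶c′≈ = record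
    { u = u ; r = r ; s = 0# ; t = 0# ; u#0 = u#0
    ; eq₁ = solve 1 (λ u → u :* :0 := :0 :+ 2 :× :0) refl u
    ; eq₂ = solve 2 (λ u r → u :^ 2 :* :0 := :0 :- :0 :* :0 :+ 3 :× r :- :0 :^ 2) refl u r
    ; eq₃ = solve 2 (λ u r → u :^ 3 :* :0 := :0 :+ r :* :0 :+ 2 :× :0) refl u r
    ; eq₄ = trans u⁴a′≈a (solve 2 (λ a r → a :=
        a :- :0 :* :0 :+ 2 :× (r :* :0) :- (:0 :+ r :* :0) :* :0 :+ 3 :× (r :^ 2) :- 2 :× (:0 :* :0))
        refl a r)
    ; eq₆ = trans u⁶c′≈ (solve 3 (λ a c r → c :+ r :* a :+ r :^ 3 :=
        c :+ r :* a :+ r :^ 2 :* :0 :+ r :^ 3 :- :0 :* :0 :- :0 :^ 2 :- r :* :0 :* :0)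
        refl a c r)
    }

  short-≅⁻¹ : ∀ {a c a′ c′} → short a c ≅ short a′ c′ →
              Σ[ u ∈ Carrier ] Σ[ r ∈ Carrier ]
                u # 0# × u ^ 4 * a′ ≈ a × u ^ 6 * c′ ≈ c + r * a + r ^ 3
  short-≅⁻¹ {a} {c} {a′} {c′} E≅E′ = u , r , u#0 , u⁴a′≈a , u⁶c′≈
    where
    open _≅_ E≅E′

    -- In characteristic 3 one has -2 = 1, so the relation 0 = 2s of `eq₁` yields s itself; `eq₃`
    -- does the same for t.
    s≈0 : s ≈ 0#
    s≈0 = begin
      s                           ≈⟨ solve 2 (λ u s → s := u :* :0 :- (:0 :+ 2 :× s)) refl u s ⟩
      u * 0# - (0# + 2 · s)       ≈⟨ x≈y⇒x∙y⁻¹≈ε eq₁ ⟩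
      0#                          ∎

    t≈0 : t ≈ 0#
    t≈0 = begin
      t                                    ≈⟨ solve 3 (λ u r t → t := u :^ 3 :* :0 :- (:0 :+ r :* :0 :+ 2 :× t)) refl u r t ⟩
      u ^ 3 * 0# - (0# + r * 0# + 2 · t)   ≈⟨ x≈y⇒x∙y⁻¹≈ε eq₃ ⟩
      0#                                   ∎

    u⁴a′≈a : u ^ 4 * a′ ≈ a
    u⁴a′≈a = begin
      u ^ 4 * a′
        ≈⟨ eq₄ ⟩
      a - s * 0# + 2 · (r * 0#) - (t + r * s) * 0# + 3 · (r ^ 2) - 2 · (s * t)
        ≈⟨ solve 4 (λ a r s t →
             a :- s :* :0 :+ 2 :× (r :* :0) :- (t :+ r :* s) :* :0 :+ 3 :× (r :^ 2) :- 2 :× (s :* t) :=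
             a :+ s :* t) refl a r s t ⟩
      a + s * t
        ≈⟨ +-congˡ (*-congʳ s≈0) ⟩
      a + 0# * t
        ≈⟨ solve 2 (λ a t → a :+ :0 :* t := a) refl a t ⟩
      a ∎

    u⁶c′≈ : u ^ 6 * c′ ≈ c + r * a + r ^ 3
    u⁶c′≈ = begin
      u ^ 6 * c′
        ≈⟨ eq₆ ⟩
      c + r * a + r ^ 2 * 0# + r ^ 3 - t * 0# - t ^ 2 - r * t * 0#
        ≈⟨ solve 4 (λ a c r t →
             c :+ r :* a :+ r :^ 2 :* :0 :+ r :^ 3 :- t :* :0 :- t :^ 2 :- r :* t :* :0 :=
             c :+ r :* a :+ r :^ 3 :- t :* t) refl a c r t ⟩
      c + r * a + r ^ 3 - t * t
        ≈⟨ +-congˡ (-‿cong (*-congʳ t≈0)) ⟩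
      c + r * a + r ^ 3 - 0# * t
        ≈⟨ solve 2 (λ x t → x :- :0 :* t := x) refl (c + r * a + r ^ 3) t ⟩
      c + r * a + r ^ 3 ∎

  typeI⇒≅curve : ∀ {a₄ a₆ v} (v#0 : v # 0#) → - a₄ ≈ v ^ 4 →
                 short a₄ a₆ ≅ curve (a₆ * inverse v#0 ^ 6)
  typeI⇒≅curve {a₄} {a₆} {v} v#0 -a₄≈v⁴ = short-≅ v 0# v#0
    (begin
      v ^ 4 * - 1#    ≈⟨ *-congʳ -a₄≈v⁴ ⟨
      - a₄ * - 1#     ≈⟨ solve 1 (λ a → :- a :* :- :1 := a) refl a₄ ⟩
      a₄              ∎)
    (begin
      v ^ 6 * (a₆ * w ^ 6)         ≈⟨ solve 3 (λ v w c → v :^ 6 :* (c :* w :^ 6) := c :* (v :* w) :^ 6) refl v w a₆ ⟩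
      a₆ * (v * w) ^ 6             ≈⟨ *-congˡ (^-congˡ 6 vw≈1) ⟩
      a₆ * 1# ^ 6                  ≈⟨ solve 2 (λ a c → c :* :1 :^ 6 := c :+ :0 :* a :+ :0 :^ 3) refl a₄ a₆ ⟩
      a₆ + 0# * a₄ + 0# ^ 3        ∎)
    where
    w : Carrier
    w = inverse v#0

    vw≈1 : v * w ≈ 1#
    vw≈1 = trans (*-congʳ (sym (x-0≈x v))) (proj₂ (proj₂ (#⇒invertible v#0)))

  -- Isomorphisms change a₄ by a fourth power u⁴ only, so the fourth root v becomes u v.
  typeI-resp-≅ : ∀ {a c a′ c′} → short a′ c′ ≅ short a c → TypeI a → TypeI a′
  typeI-resp-≅ {a} {_} {a′} E′≅E (v , v#0 , -a≈v⁴) =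
    let u , _ , u#0 , u⁴a≈a′ , _ = short-≅⁻¹ E′≅E in
    u * v , x#0y#0→xy#0 u#0 v#0 , (begin
    - a′             ≈⟨ -‿cong u⁴a≈a′ ⟨
    - (u ^ 4 * a)    ≈⟨ -‿distribʳ-* (u ^ 4) a ⟩
    u ^ 4 * - a      ≈⟨ *-congˡ -a≈v⁴ ⟩
    u ^ 4 * v ^ 4    ≈⟨ solve 2 (λ u v → u :^ 4 :* v :^ 4 := (u :* v) :^ 4) refl u v ⟩
    (u * v) ^ 4      ∎)

  -- The negative alternative also records a square root of -1, namely u, so that odd d refutes it
  -- outright.
  curve-≅⇒Tr≈±Tr : ∀ {b b′} → curve b ≅ curve b′ →
                    Tr b ≈ Tr b′ ⊎ (∃[ i ] - 1# ≈ i ^ 2) × Tr b ≈ - Tr b′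
  curve-≅⇒Tr≈±Tr {b} {b′} E≅E′ = u²-cases (x≈±y (begin
      (u ^ 2) ^ 2          ≈⟨ solve 1 (λ u → (u :^ 2) :^ 2 := :- (u :^ 4 :* :- :1)) refl u ⟩
      - (u ^ 4 * - 1#)     ≈⟨ -‿cong -u⁴≈-1 ⟩
      - - 1#               ≈⟨ solve 0 (:- :- :1 := :1 :^ 2) refl ⟩
      1# ^ 2               ∎))
    where
    substitution : Σ[ u ∈ Carrier ] Σ[ r ∈ Carrier ]
                     u # 0# × u ^ 4 * - 1# ≈ - 1# × u ^ 6 * b′ ≈ b + r * - 1# + r ^ 3
    substitution = short-≅⁻¹ E≅E′

    u r : Carrier
    u = proj₁ substitution
    r = proj₁ (proj₂ substitution)

    -u⁴≈-1 : u ^ 4 * - 1# ≈ - 1#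
    -u⁴≈-1 = proj₁ (proj₂ (proj₂ (proj₂ substitution)))

    u⁶b′≈ : u ^ 6 * b′ ≈ b + r * - 1# + r ^ 3
    u⁶b′≈ = proj₂ (proj₂ (proj₂ (proj₂ substitution)))

    -- Both values of u² are treated at once: u⁶ = e³, and the contribution of r is killed by the
    -- trace.
    Trb≈ : ∀ {e} → u ^ 2 ≈ e → Tr b ≈ Tr (e ^ 3 * b′)
    Trb≈ {e} u²≈e = begin
      Tr b                             ≈⟨ +-identityʳ (Tr b) ⟨
      Tr b + 0#                        ≈⟨ +-congˡ (Tr-x³-x r) ⟨
      Tr b + Tr (r ^ 3 - r)            ≈⟨ trace-+ d b (r ^ 3 - r) ⟨
      Tr (b + (r ^ 3 - r))             ≈⟨ trace-cong d b+r³-r≈ ⟩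
      Tr (e ^ 3 * b′)                  ∎
      where
      b+r³-r≈ : b + (r ^ 3 - r) ≈ e ^ 3 * b′
      b+r³-r≈ = begin
        b + (r ^ 3 - r)          ≈⟨ solve 2 (λ b r → b :+ (r :^ 3 :- r) := b :+ r :* :- :1 :+ r :^ 3) refl b r ⟩
        b + r * - 1# + r ^ 3     ≈⟨ u⁶b′≈ ⟨
        u ^ 6 * b′               ≈⟨ *-congʳ (^-assocʳ u 2 3) ⟨
        (u ^ 2) ^ 3 * b′         ≈⟨ *-congʳ (^-congˡ 3 u²≈e) ⟩
        e ^ 3 * b′               ∎

    u²-cases : u ^ 2 ≈ 1# ⊎ u ^ 2 ≈ - 1# →
               Tr b ≈ Tr b′ ⊎ (∃[ i ] - 1# ≈ i ^ 2) × Tr b ≈ - Tr b′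
    u²-cases (inj₁ u²≈1)  = inj₁ (trans (Trb≈ u²≈1)
      (trace-cong d (solve 1 (λ b → :1 :^ 3 :* b := b) refl b′)))
    u²-cases (inj₂ u²≈-1) = inj₂ ((u , sym u²≈-1) , trans (Trb≈ u²≈-1)
      (trans (trace-cong d (solve 1 (λ b → (:- :1) :^ 3 :* b := :- b) refl b′)) (trace-neg d b′)))

  -- Classification of the curves E_b by the trace.

  module Classification (α : Carrier) (Trα≈1 : Tr α ≈ 1#) where

    -- Once u normalises a′, the remaining obstruction u⁶c′ - b has trace zero and is absorbed by a
    -- translation r. The target is an arbitrary short equation so that the quadratic twist is
    -- covered as it is written.
    curve-≅-short : ∀ {b a′ c′} (u : Carrier) → u # 0# → u ^ 4 * a′ ≈ - 1# →
                    Tr b ≈ Tr (u ^ 6 * c′) → curve b ≅ short a′ c′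
    curve-≅-short {b} {_} {c′} u u#0 u⁴a′≈-1 Trb≈ =
      let r , r³-r≈ = artin-schreier {b = u ^ 6 * c′ - b} Trα≈1
            (trans (trace-- d (u ^ 6 * c′) b) (x≈y⇒x∙y⁻¹≈ε (sym Trb≈)))
      in short-≅ u r u#0 u⁴a′≈-1 (begin
      u ^ 6 * c′                  ≈⟨ solve 2 (λ x b → x := b :+ (x :- b)) refl (u ^ 6 * c′) b ⟩
      b + (u ^ 6 * c′ - b)        ≈⟨ +-congˡ r³-r≈ ⟨
      b + (r ^ 3 - r)             ≈⟨ solve 2 (λ b r → b :+ (r :^ 3 :- r) := b :+ r :* :- :1 :+ r :^ 3) refl b r ⟩
      b + r * - 1# + r ^ 3        ∎)

    Tr≈⇒curve-≅ : ∀ {b b′} → Tr b ≈ Tr b′ → curve b ≅ curve b′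
    Tr≈⇒curve-≅ {b} {b′} Trb≈Trb′ = curve-≅-short 1# 1#0
      (solve 0 (:1 :^ 4 :* :- :1 := :- :1) refl)
      (trans Trb≈Trb′ (trace-cong d (solve 1 (λ b → b := :1 :^ 6 :* b) refl b′)))

    -- Scaling by u = i preserves the coefficient -1, as i⁴ = 1, and flips the sign of the constant
    -- term, as i⁶ = -1.
    Tr≈-Tr⇒curve-≅ : ∃[ i ] i ^ 2 ≈ - 1# → ∀ {b b′} → Tr b ≈ - Tr b′ → curve b ≅ curve b′
    Tr≈-Tr⇒curve-≅ (i , i²≈-1) {b} {b′} Trb≈-Trb′ = curve-≅-short i i#0
      (begin
        i ^ 4 * - 1#          ≈⟨ *-congʳ (^-assocʳ i 2 2) ⟨
        (i ^ 2) ^ 2 * - 1#    ≈⟨ *-congʳ (^-congˡ 2 i²≈-1) ⟩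
        (- 1#) ^ 2 * - 1#     ≈⟨ solve 0 ((:- :1) :^ 2 :* :- :1 := :- :1) refl ⟩
        - 1#                  ∎)
      (begin
        Tr b                  ≈⟨ Trb≈-Trb′ ⟩
        - Tr b′               ≈⟨ trace-neg d b′ ⟨
        Tr (- b′)             ≈⟨ trace-cong d -b′≈i⁶b′ ⟩
        Tr (i ^ 6 * b′)       ∎)
      where
      -b′≈i⁶b′ : - b′ ≈ i ^ 6 * b′
      -b′≈i⁶b′ = begin
        - b′                  ≈⟨ solve 1 (λ b → :- b := (:- :1) :^ 3 :* b) refl b′ ⟩
        (- 1#) ^ 3 * b′       ≈⟨ *-congʳ (^-congˡ 3 i²≈-1) ⟨
        (i ^ 2) ^ 3 * b′      ≈⟨ *-congʳ (^-assocʳ i 2 3) ⟩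
        i ^ 6 * b′            ∎

      i#0 : i # 0#
      i#0 = ≉0⇒#0 (λ i≈0 → 0≉-1 (trans (sym (trans (*-congʳ i≈0) (zeroˡ (i * 1#)))) i²≈-1))

    Tr0 : Tr 0# ≈ 0#
    Tr0 = trace-0 d

    Tr-α : Tr (- α) ≈ - 1#
    Tr-α = trans (trace-neg d α) (-‿cong Trα≈1)

    Tr≈0⇒≅0 : ∀ b → Tr b ≈ 0# → curve b ≅ curve 0#
    Tr≈0⇒≅0 b Trb≈0 = Tr≈⇒curve-≅ (trans Trb≈0 (sym Tr0))

    Tr≈1⇒≅α : ∀ b → Tr b ≈ 1# → curve b ≅ curve α
    Tr≈1⇒≅α b Trb≈1 = Tr≈⇒curve-≅ (trans Trb≈1 (sym Trα≈1))

    -- Up to ring identities the twist is E_c with c = -α, whose trace is -1.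
    Tr≈-1⇒≅twist : ∀ nonSquare b → Tr b ≈ - 1# →
                   curve b ≅ quadraticTwist (- 1#) nonSquare (- 1#) α
    Tr≈-1⇒≅twist _ b Trb≈-1 = curve-≅-short 1# 1#0
      (solve 0 (:1 :^ 4 :* ((:- :1) :^ 2 :* :- :1) := :- :1) refl)
      (trans (trans Trb≈-1 (sym Tr-α))
        (trace-cong d (solve 1 (λ a → :- a := :1 :^ 6 :* ((:- :1) :^ 3 :* a)) refl α)))

    module Odd (2∤d : 2 ∤ d) where

      curve-≅⇒Tr≈ : ∀ {b b′} → curve b ≅ curve b′ → Tr b ≈ Tr b′
      curve-≅⇒Tr≈ E≅E′ =
        [ id , ⊥-elim ∘ -1-nonSquare 2∤d ∘ proj₁ ]′ (curve-≅⇒Tr≈±Tr E≅E′)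

      -- The classes are counted on parameters b, so the class of the twist is represented by -α.
      representative : Fin 3 → Carrier
      representative 0F = 0#
      representative 1F = α
      representative 2F = - α

      separates : ∀ i j → Tr (representative i) ≈ Tr (representative j) → i ≡ j
      separates 0F 0F _  = ≡.refl
      separates 1F 1F _  = ≡.refl
      separates 2F 2F _  = ≡.refl
      separates 0F 1F eq = contradiction (trans (sym Trα≈1) (trans (sym eq) Tr0)) 1≉0
      separates 1F 0F eq = contradiction (trans (sym Trα≈1) (trans eq Tr0)) 1≉0
      separates 0F 2F eq = contradiction (trans (sym Tr0) (trans eq Tr-α)) 0≉-1
      separates 2F 0F eq = contradiction (trans (sym Tr0) (trans (sym eq) Tr-α)) 0≉-1
      separates 1F 2F eq = contradiction (trans (sym Trα≈1) (trans eq Tr-α)) 1≉-1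
      separates 2F 1F eq = contradiction (trans (sym Trα≈1) (trans (sym eq) Tr-α)) 1≉-1

      classify : ∀ b → ∃[ i ] curve b ≅ curve (representative i)
      classify b with traceValue b
      ... | Tr≈0  eq = 0F , Tr≈0⇒≅0 b eq
      ... | Tr≈1  eq = 1F , Tr≈1⇒≅α b eq
      ... | Tr≈-1 eq = 2F , Tr≈⇒curve-≅ (trans eq (sym Tr-α))

      exactlyThree : HasExactlyClasses 3 (λ b b′ → curve b ≅ curve b′)
      exactlyThree = representative , (λ i j → separates i j ∘ curve-≅⇒Tr≈) , classify

    module Even (√-1 : ∃[ i ] i ^ 2 ≈ - 1#) where

      Tr≉0⇒≅α : ∀ b → ¬ (Tr b ≈ 0#) → curve b ≅ curve α
      Tr≉0⇒≅α b Trb≉0 with traceValue b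
      ... | Tr≈0  eq = contradiction eq Trb≉0
      ... | Tr≈1  eq = Tr≈1⇒≅α b eq
      ... | Tr≈-1 eq = Tr≈-Tr⇒curve-≅ √-1 (trans eq (-‿cong (sym Trα≈1)))

      representative : Fin 2 → Carrier
      representative 0F = 0#
      representative 1F = α

      -- The traces 0 and 1 of the representatives differ even up to sign.
      separates : ∀ i j → curve (representative i) ≅ curve (representative j) → i ≡ j
      separates 0F 0F _ = ≡.refl
      separates 1F 1F _ = ≡.refl
      separates 0F 1F E≅E′ = ⊥-elim ([
          (λ eq       → 1≉0 (trans (sym Trα≈1) (trans (sym eq) Tr0)))
        , (λ (_ , eq) → 0≉-1 (trans (sym Tr0) (trans eq (-‿cong Trα≈1))))
        ]′ (curve-≅⇒Tr≈±Tr E≅E′))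
      separates 1F 0F E≅E′ = ⊥-elim ([
          (λ eq       → 1≉0 (trans (sym Trα≈1) (trans eq Tr0)))
        , (λ (_ , eq) → 1≉0 (trans (sym Trα≈1) (trans eq (trans (-‿cong Tr0) -0#≈0#))))
        ]′ (curve-≅⇒Tr≈±Tr E≅E′))

      classify : ∀ b → ∃[ i ] curve b ≅ curve (representative i)
      classify b with Tr b ≈? 0#
      ... | yes eq    = 0F , Tr≈0⇒≅0 b eq
      ... | no  Trb≉0 = 1F , Tr≉0⇒≅α b Trb≉0

      exactlyTwo : HasExactlyClasses 2 (λ b b′ → curve b ≅ curve b′)
      exactlyTwo = representative , separates , classify

mainTheorem1 : ∀ {c ℓ₁ ℓ₂ : Level} (F : HeytingField c ℓ₁ ℓ₂) (d : ℕ) → 1 ≤ d →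
  let open HeytingField F
      open OverField F
      Tr = trace d
  in
  HasCardinality (3 ^ℕ d) →
  (α : Carrier) → Tr α ≈ 1# →
  ((a₄ a₆ : Carrier) → IsElliptic (short a₄ a₆) →
    (v : Carrier) (typeI : TypeIVia v a₄) →
      (short a₄ a₆ ≅ curve (a₆ * inverse (proj₁ typeI) ^ 6))
      × ((a₄' a₆' : Carrier) → IsElliptic (short a₄' a₆') →
          short a₄' a₆' ≅ short a₄ a₆ → TypeI a₄'))
  × (2 ∤ d →
      HasExactlyClasses 3 (λ b b' → curve b ≅ curve b')
      × ((b b' : Carrier) → (curve b ≅ curve b') ⇔ (Tr b ≈ Tr b'))
      × (Σ[ nonSquare ∈ NonSquare (- 1#) ]
          ((b : Carrier) →
            (Tr b ≈ 0# → curve b ≅ curve 0#)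
            × (Tr b ≈ 1# → curve b ≅ curve α)
            × (Tr b ≈ - 1# → curve b ≅ quadraticTwist (- 1#) nonSquare (- 1#) α))))
  × (2 ∣ d →
      HasExactlyClasses 2 (λ b b' → curve b ≅ curve b')
      × ((b : Carrier) →
          (Tr b ≈ 0# → curve b ≅ curve 0#)
          × (¬ (Tr b ≈ 0#) → curve b ≅ curve α)))
mainTheorem1 F d 1≤d card α Trα≈1 =
    (λ a₄ a₆ _ v typeI →
        typeI⇒≅curve (proj₁ typeI) (proj₂ typeI)
      , λ a₄' a₆' _ E′≅E → typeI-resp-≅ E′≅E (v , typeI))
  , (λ 2∤d → let open Odd 2∤d in
        exactlyThree
      , (λ b b' → mk⇔ curve-≅⇒Tr≈ Tr≈⇒curve-≅)
      , -1-nonSquare 2∤d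
      , λ b → Tr≈0⇒≅0 b , Tr≈1⇒≅α b , Tr≈-1⇒≅twist (-1-nonSquare 2∤d) b)
  , (λ 2∣d → let open Even (√-1 1≤d 2∣d) in
        exactlyTwo
      , λ b → Tr≈0⇒≅0 b , Tr≉0⇒≅α b)
  where
  open FiniteFieldOfCharacteristic3 F d card
  open Classification α Trα≈1
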